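{- Let $k \geq 1$ be an integer. For all graphs $G_1, G_2$, $$\alpha_k(G_1 \boxtimes G_2) \geq \alpha_k(G_1) \cdot \alpha_k(G_2).$$
   Context: Graphs are finite, simple and undirected. For a graph $G$, $\delta_G(u,v)$ is the length of a shortest path between vertices $u$ and $v$ in $G$ (equal to $\infty$ if there is none). A set $S \subseteq V(G)$ is $k$-independent if $\delta_G(u,v) > k$ for all distinct $u,v \in S$; $\alpha_k(G)$ denotes the maximum size of a $k$-independent set in $G$. The strong product $G_1 \boxtimes G_2$ has vertex set $V(G_1)\times V(G_2)$, and two distinct vertices $(u_1,u_2),(v_1,v_2)$ are adjacent if and only if ($u_1=v_1$ or $(u_1,v_1)\in E(G_1)$) and ($u_2=v_2$ or $(u_2,v_2)\in E(G_2)$). -}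

module Defs where

open import Data.Fin.Base using (Fin)
open import Data.Fin.Properties as Fin using (*↔×; any?; all?; injective⇒≤)
open import Data.Fin.Subset as Subset using (Subset; ∣_∣; inside; outside)
open import Data.Fin.Subset.Properties using (_∈?_; ∉⊥; ∣⊥∣≡0)
open import Data.List.Base as List using (List; []; _∷_; _++_; filter; upTo)
import Data.List.Extrema as Extrema
import Data.List.Extrema.Nat as ℕ-Extrema
open import Data.List.Membership.Propositional using () renaming (_∈_ to _∈ᴸ_)
open import Data.List.Membership.Propositional.Properties
  using (∈-map⁺; ∈-map⁻; ∈-filter⁺; ∈-filter⁻; ∈-upTo⁺; ∈-++⁺ˡ; ∈-++⁺ʳ)
open import Data.List.Relation.Unary.All as All using ()
open import Data.List.Relation.Unary.Any using (here)
open import Data.Nat.Base using (ℕ; zero; suc; _*_; _≤_; _<_)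
open import Data.Nat.Properties as ℕ using ()
open import Data.Product.Base using (∃; ∃-syntax; _×_; _,_; proj₂)
open import Data.Product.Function.NonDependent.Propositional using (_×-↔_)
open import Data.Product.Properties using (≡-dec)
open import Data.Sum.Base as Sum using (_⊎_; inj₁; inj₂)
open import Data.Vec.Base using (Vec; []; _∷_; head; last; lookup)
open import Data.Vec.Relation.Unary.AllPairs using (allPairs?)
open import Data.Vec.Relation.Unary.Linked using (Linked; linked?)
open import Data.Vec.Relation.Unary.Unique.Propositional using (Unique)
open import Data.Vec.Relation.Unary.Unique.Propositional.Properties using (lookup-injective)
open import Function.Base using (_∘_)
open import Function.Bundles using (_↔_; Inverse)
open import Function.Construct.Composition using (_↔-∘_)
open import Function.Construct.Symmetry using (↔-sym)
open import Function.Properties.Inverse using (↔⇒↣)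
open import Relation.Binary.Bundles using (TotalOrder)
import Relation.Binary.Construct.Add.Supremum.NonStrict as NonStrict
import Relation.Binary.Construct.Add.Supremum.Strict as Strict
open import Relation.Binary.Definitions
  using (Decidable; DecidableEquality; Irreflexive; Symmetric)
open import Relation.Binary.PropositionalEquality
  using (_≡_; _≢_; refl; sym; trans; cong; subst)
open import Relation.Nullary using (Dec; contradiction)
open import Relation.Nullary.Construct.Add.Supremum using (_⁺; ⊤⁺; [_])
open import Relation.Nullary.Decidable using (map′; via-injection; ¬?; _×-dec_; _⊎-dec_; _→-dec_)
import Relation.Unary as U

-- Distances take values in ℕ ∪ {∞}, with ∞ = ⊤⁺

ℕ∞ : Set
ℕ∞ = ℕ ⁺

open Strict _<_ public using () renaming (_<⁺_ to _<∞_; <⁺-dec to <∞-dec)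
open NonStrict _≤_ public using () renaming (_≤⁺_ to _≤∞_)

≤∞-totalOrder : TotalOrder _ _ _
≤∞-totalOrder = record
  { isTotalOrder = NonStrict.≤⁺-isTotalOrder-≡ _≤_ ℕ.≤-isTotalOrder }

_<∞?_ : Decidable _<∞_
_<∞?_ = <∞-dec ℕ._<?_

-- Finiteness is an enumeration of the vertices; it is also how a subset
-- of V is encoded as a `Subset order`.  Decidability of adjacency holds
-- for every finite graph classically; it makes δ and α computable.

record Graph : Set₁ where
  infix 4 _~_ _~?_ _≟_ _∈_
  field
    V        : Set
    order    : ℕ
    enum     : V ↔ Fin order
    _~_      : V → V → Set
    _~?_     : Decidable _~_
    ~-sym    : Symmetric _~_
    ~-irrefl : Irreflexive _≡_ _~_

  index : V → Fin order
  index = Inverse.to enum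

  vertex : Fin order → V
  vertex = Inverse.from enum

  vertex∘index : ∀ v → vertex (index v) ≡ v
  vertex∘index = Inverse.strictlyInverseʳ enum

  index-injective : ∀ {u v} → index u ≡ index v → u ≡ v
  index-injective {u} {v} eq =
    trans (sym (vertex∘index u)) (trans (cong vertex eq) (vertex∘index v))

  _≟_ : DecidableEquality V
  _≟_ = via-injection (↔⇒↣ enum) Fin._≟_

  anyVertex? : ∀ {P : V → Set} → U.Decidable P → Dec (∃ P)
  anyVertex? {P} P? = map′
    (λ (i , p) → vertex i , p)
    (λ (v , p) → index v , subst P (sym (vertex∘index v)) p)
    (any? (P? ∘ vertex))

  allVertices? : ∀ {P : V → Set} → U.Decidable P → Dec (∀ v → P v)
  allVertices? {P} P? = map′
    (λ p v → subst P (vertex∘index v) (p (index v)))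
    (λ p i → p (vertex i))
    (all? (P? ∘ vertex))

  anyVec? : ∀ {n} {P : Vec V n → Set} → U.Decidable P → Dec (∃ P)
  anyVec? {zero}  P? = map′ ([] ,_) (λ { ([] , p) → p }) (P? [])
  anyVec? {suc n} P? = map′
    (λ (v , vs , p) → v ∷ vs , p)
    (λ { (v ∷ vs , p) → v , vs , p })
    (anyVertex? (λ v → anyVec? (P? ∘ (v ∷_))))

  IsPath : ∀ {ℓ} → V → V → Vec V (suc ℓ) → Set
  IsPath u v p = head p ≡ u × last p ≡ v × Linked _~_ p × Unique p

  -- The length of a path is its number of edges.

  Path : V → V → ℕ → Set
  Path u v ℓ = ∃[ p ] IsPath {ℓ} u v p

  path? : ∀ u v → U.Decidable (Path u v)
  path? u v ℓ = anyVec? λ p →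
    head p ≟ u ×-dec last p ≟ v ×-dec
    linked? _~?_ p ×-dec allPairs? (λ x y → ¬? (x ≟ y)) p

  path-length<order : ∀ {u v ℓ} → Path u v ℓ → ℓ < order
  path-length<order (p , _ , _ , _ , unique) =
    injective⇒≤ {f = index ∘ lookup p}
      (λ eq → lookup-injective unique _ _ (index-injective eq))

  -- By path-length<order this list contains every length of a path.

  pathLengths : V → V → List ℕ
  pathLengths u v = filter (path? u v) (upTo order)

  δ : V → V → ℕ∞
  δ u v = Extrema.min ≤∞-totalOrder ⊤⁺ (List.map [_] (pathLengths u v))

  δ-minimum : ∀ {u v ℓ} → Path u v ℓ → δ u v ≤∞ [ ℓ ]
  δ-minimum {u} {v} p = All.lookup
    (Extrema.min≤xs ≤∞-totalOrder ⊤⁺ (List.map [_] (pathLengths u v)))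
    (∈-map⁺ [_] (∈-filter⁺ (path? u v) (∈-upTo⁺ (path-length<order p)) p))

  δ-attained : ∀ {u v d} → δ u v ≡ [ d ] → Path u v d
  δ-attained {u} {v} eq
    with Extrema.argmin-sel ≤∞-totalOrder (λ x → x) ⊤⁺ (List.map [_] (pathLengths u v))
  ... | inj₁ δ≡∞ = contradiction (trans (sym eq) δ≡∞) λ ()
  ... | inj₂ δ∈  with ∈-map⁻ [_] (subst (_∈ᴸ List.map [_] (pathLengths u v)) eq δ∈)
  ...   | _ , d∈ , refl = proj₂ (∈-filter⁻ (path? u v) {xs = upTo order} d∈)

  _∈_ : V → Subset order → Set
  v ∈ S = index v Subset.∈ S

  Independent : ℕ → Subset order → Set
  Independent k S = ∀ u v → u ∈ S → v ∈ S → u ≢ v → [ k ] <∞ δ u v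

  independent? : ∀ k → U.Decidable (Independent k)
  independent? k S = allVertices? λ u → allVertices? λ v →
    (index u ∈? S) →-dec (index v ∈? S) →-dec ¬? (u ≟ v) →-dec ([ k ] <∞? δ u v)

subsets : ∀ n → List (Subset n)
subsets zero    = [] ∷ []
subsets (suc n) = List.map (inside ∷_) (subsets n) ++ List.map (outside ∷_) (subsets n)

subsets-complete : ∀ {n} (S : Subset n) → S ∈ᴸ subsets n
subsets-complete []            = here refl
subsets-complete (inside  ∷ S) = ∈-++⁺ˡ (∈-map⁺ (inside ∷_) (subsets-complete S))
subsets-complete (outside ∷ S) =
  ∈-++⁺ʳ (List.map (inside ∷_) (subsets _)) (∈-map⁺ (outside ∷_) (subsets-complete S))

independentSets : ℕ → (G : Graph) → List (Subset (Graph.order G))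
independentSets k G = filter (Graph.independent? G k) (subsets (Graph.order G))

-- The default value 0 does not matter: the empty set is independent.

α : ℕ → Graph → ℕ
α k G = ℕ-Extrema.max 0 (List.map ∣_∣ (independentSets k G))

module _ (k : ℕ) (G : Graph) where
  open Graph G

  α-maximum : ∀ {S} → Independent k S → ∣ S ∣ ≤ α k G
  α-maximum {S} indep = All.lookup
    (ℕ-Extrema.xs≤max 0 (List.map ∣_∣ (independentSets k G)))
    (∈-map⁺ ∣_∣ (∈-filter⁺ (independent? k) (subsets-complete S) indep))

  α-attained : ∃[ S ] Independent k S × ∣ S ∣ ≡ α k G
  α-attained
    with ℕ-Extrema.argmax-sel (λ m → m) 0 (List.map ∣_∣ (independentSets k G))
  ... | inj₁ α≡0 =
    Subset.⊥ , (λ _ _ u∈⊥ → contradiction u∈⊥ ∉⊥) , trans (∣⊥∣≡0 order) (sym α≡0)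
  ... | inj₂ α∈  with ∈-map⁻ ∣_∣ α∈
  ...   | S , S∈ , eq =
    S , proj₂ (∈-filter⁻ (independent? k) {xs = subsets order} S∈) , sym eq

infixl 7 _⊠_

_⊠_ : Graph → Graph → Graph
G₁ ⊠ G₂ = record
  { V        = G₁.V × G₂.V
  ; order    = G₁.order * G₂.order
  ; enum     = ↔-sym *↔× ↔-∘ (G₁.enum ×-↔ G₂.enum)
  ; _~_      = λ (u₁ , u₂) (v₁ , v₂) →
                 (u₁ , u₂) ≢ (v₁ , v₂) ×
                 (u₁ ≡ v₁ ⊎ u₁ G₁.~ v₁) ×
                 (u₂ ≡ v₂ ⊎ u₂ G₂.~ v₂)
  ; _~?_     = λ (u₁ , u₂) (v₁ , v₂) →
                 ¬? (≡-dec G₁._≟_ G₂._≟_ (u₁ , u₂) (v₁ , v₂)) ×-dec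
                 ((u₁ G₁.≟ v₁) ⊎-dec (u₁ G₁.~? v₁)) ×-dec
                 ((u₂ G₂.≟ v₂) ⊎-dec (u₂ G₂.~? v₂))
  ; ~-sym    = λ (u≢v , a₁ , a₂) →
                 u≢v ∘ sym , Sum.map sym G₁.~-sym a₁ , Sum.map sym G₂.~-sym a₂
  ; ~-irrefl = λ u≡v (u≢v , _) → u≢v u≡v
  }
  where
  module G₁ = Graph G₁
  module G₂ = Graph G₂

{-# OPTIONS --safe #-}

-- The projections of G₁ ⊠ G₂ to its factors map an edge to an edge or to a
-- single vertex, so they do not increase distances.  Distinct vertices of
-- S₁ × S₂ differ in some coordinate, and are there more than k apart when S₁ and
-- S₂ are k-independent.  Hence S₁ × S₂ is k-independent, of size ∣ S₁ ∣ * ∣ S₂ ∣.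

module Submission where

open import Defs
open import Data.Nat.Base using (ℕ; _*_; _≥_)

open import Data.Bool.Base using (true; false; _∧_)
open import Data.Fin.Base using (combine)
open import Data.Fin.Subset as Subset using (Subset; ∣_∣)
open import Data.Nat.Base using (suc; _+_; _≤_; s≤s)
import Data.Nat.Properties as ℕ
open import Data.Product.Base using (∃-syntax; _×_; _,_)
open import Data.Sum.Base using (_⊎_; inj₁; inj₂)
open import Data.Vec.Base using (Vec; []; _∷_; _++_; _⊛*_; head; last; lookup; map)
open import Data.Vec.Properties using ([]=⇒lookup; lookup⇒[]=; lookup-⊛*; lookup-map; map-id)
open import Data.Vec.Relation.Unary.All using (All; []; _∷_)
open import Data.Vec.Relation.Unary.AllPairs using ([]; _∷_)
open import Data.Vec.Relation.Unary.Linked using (Linked; [-]; _∷_)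
open import Data.Vec.Relation.Unary.Unique.Propositional using (Unique)
import Relation.Binary.Construct.Add.Supremum.NonStrict as NonStrict
import Relation.Binary.Construct.Add.Supremum.Strict as Strict
open import Relation.Binary.PropositionalEquality
  using (_≡_; _≢_; refl; sym; trans; cong; cong₂; subst)
open import Relation.Nullary using (yes; no)
open import Relation.Nullary.Construct.Add.Supremum using (⊤⁺; [_])

module _ (G : Graph) where
  open Graph G

  -- A bound rather than an exact length, since collapsed edges and removed cycles shorten a path by
  -- an unknown amount.
  Path≤ : V → V → ℕ → Set
  Path≤ u v n = ∃[ ℓ ] ℓ ≤ n × Path u v ℓ

  -- A path has distinct vertices, so `x` can be put in front of `p` only if `p` avoids it.
  -- Otherwise the part of `p` from `x` onwards is already a path from `x` to the same end.
  avoids⊎suffix : ∀ x {ℓ} (p : Vec V (suc ℓ)) → Linked _~_ p → Unique p →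
                  All (x ≢_) p ⊎ Path≤ x (last p) ℓ
  avoids⊎suffix x (y ∷ ys) linked unique with x ≟ y
  ... | yes x≡y = inj₂ (_ , ℕ.≤-refl , y ∷ ys , sym x≡y , refl , linked , unique)
  avoids⊎suffix x (y ∷ []) linked unique | no x≢y = inj₁ (x≢y ∷ [])
  avoids⊎suffix x (y ∷ ys@(_ ∷ _)) (_ ∷ linked) (_ ∷ unique) | no x≢y
    with avoids⊎suffix x ys linked unique
  ... | inj₁ x∉ys          = inj₁ (x≢y ∷ x∉ys)
  ... | inj₂ (ℓ , ℓ≤ , p)  = inj₂ (ℓ , ℕ.m≤n⇒m≤1+n ℓ≤ , p)

  prepend : ∀ {x u v n} → x ≡ u ⊎ x ~ u → Path≤ u v n → Path≤ x v (suc n)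
  prepend (inj₁ refl) (ℓ , ℓ≤n , p) = ℓ , ℕ.m≤n⇒m≤1+n ℓ≤n , p
  prepend {x} (inj₂ x~u) (ℓ , ℓ≤n , p , refl , refl , linked , unique)
    with avoids⊎suffix x p linked unique
  ... | inj₁ x∉p             = suc ℓ , s≤s ℓ≤n , x ∷ p , refl , refl , x~u ∷ linked , x∉p ∷ unique
  ... | inj₂ (ℓ′ , ℓ′≤ℓ , q) = ℓ′ , ℕ.m≤n⇒m≤1+n (ℕ.≤-trans ℓ′≤ℓ ℓ≤n) , q

module _ (G H : Graph) where
  private
    module G = Graph G
    module H = Graph H

  WeakHomomorphism : (G.V → H.V) → Set
  WeakHomomorphism f = ∀ {u v} → u G.~ v → f u ≡ f v ⊎ f u H.~ f v

  module _ {f : G.V → H.V} (weakHom : WeakHomomorphism f) where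

    -- The image of `p` under `f` can stall or revisit vertices. It is rebuilt from its last vertex
    -- backwards, and `prepend` cuts out each cycle as it closes.
    image-path : ∀ {ℓ} (p : Vec G.V (suc ℓ)) → Linked G._~_ p →
                 Path≤ H (f (head p)) (f (last p)) ℓ
    image-path (v ∷ []) [-] = 0 , ℕ.≤-refl , f v ∷ [] , refl , refl , [-] , [] ∷ []
    image-path (_ ∷ p@(_ ∷ _)) (v~p ∷ linked) = prepend H (weakHom v~p) (image-path p linked)

    δ-nonexpansive : ∀ u v → H.δ (f u) (f v) ≤∞ G.δ u v
    δ-nonexpansive u v with G.δ u v in eq
    ... | ⊤⁺    = _ NonStrict.≤⊤⁺
    ... | [ d ] with G.δ-attained eq
    ...   | p , refl , refl , linked , _ with image-path p linked
    ...     | _ , ℓ≤d , q = NonStrict.≤⁺-trans _≤_ ℕ.≤-trans (H.δ-minimum q) NonStrict.[ ℓ≤d ]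

    independent-pullback : ∀ {k S u v} → H.Independent k S →
      f u H.∈ S → f v H.∈ S → f u ≢ f v → [ k ] <∞ G.δ u v
    independent-pullback {u = u} {v} indep fu∈S fv∈S fu≢fv =
      Strict.<⁺-transˡ _ ℕ.<-≤-trans (indep _ _ fu∈S fv∈S fu≢fv) (δ-nonexpansive u v)

infixr 7 _×ˢ_

-- `⊛*` concatenates one block of length `n` per entry of `S`. This is the ordering of `combine`,
-- through which `⊠` enumerates pairs of vertices.
_×ˢ_ : ∀ {m n} → Subset m → Subset n → Subset (m * n)
S ×ˢ T = map _∧_ S ⊛* T

lookup-×ˢ : ∀ {m n} (S : Subset m) (T : Subset n) i j →
            lookup (S ×ˢ T) (combine i j) ≡ lookup S i ∧ lookup T j
lookup-×ˢ S T i j = trans (lookup-⊛* (map _∧_ S) T i j)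
  (cong (λ f → f (lookup T j)) (lookup-map i _∧_ S))

∧-true⁻ : ∀ {x y} → x ∧ y ≡ true → x ≡ true × y ≡ true
∧-true⁻ {true} eq = refl , eq

∈-×ˢ⁻ : ∀ {m n} (S : Subset m) (T : Subset n) {i j} →
        combine i j Subset.∈ S ×ˢ T → i Subset.∈ S × j Subset.∈ T
∈-×ˢ⁻ S T {i} {j} ij∈ with ∧-true⁻ (trans (sym (lookup-×ˢ S T i j)) ([]=⇒lookup ij∈))
... | Si , Tj = lookup⇒[]= i S Si , lookup⇒[]= j T Tj

∣++∣ : ∀ {m n} (S : Subset m) (T : Subset n) → ∣ S ++ T ∣ ≡ ∣ S ∣ + ∣ T ∣
∣++∣ []          T = refl
∣++∣ (true  ∷ S) T = cong suc (∣++∣ S T)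
∣++∣ (false ∷ S) T = ∣++∣ S T

∣map-false∣ : ∀ {n} (T : Subset n) → ∣ map (false ∧_) T ∣ ≡ 0
∣map-false∣ []      = refl
∣map-false∣ (_ ∷ T) = ∣map-false∣ T

-- Count block by block: an element of `S` contributes a copy of `T`, a non-element an empty block.
∣×ˢ∣ : ∀ {m n} (S : Subset m) (T : Subset n) → ∣ S ×ˢ T ∣ ≡ ∣ S ∣ * ∣ T ∣
∣×ˢ∣ []          T = refl
∣×ˢ∣ (true  ∷ S) T = trans (∣++∣ (map (true ∧_) T) (S ×ˢ T))
  -- `true ∧_` is the identity by computation, so `map-id` applies to the first block.
  (cong₂ _+_ (cong ∣_∣ (map-id T)) (∣×ˢ∣ S T))
∣×ˢ∣ (false ∷ S) T = trans (∣++∣ (map (false ∧_) T) (S ×ˢ T))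
  (cong₂ _+_ (∣map-false∣ T) (∣×ˢ∣ S T))

module _ (G₁ G₂ : Graph) where
  private
    module G₁ = Graph G₁
    module G₂ = Graph G₂
    module G = Graph (G₁ ⊠ G₂)

  ×ˢ-independent : ∀ {k S₁ S₂} → G₁.Independent k S₁ → G₂.Independent k S₂ →
                   G.Independent k (S₁ ×ˢ S₂)
  ×ˢ-independent {S₁ = S₁} {S₂} indep₁ indep₂ (u₁ , u₂) (v₁ , v₂) u∈ v∈ u≢v
    -- The index of a pair in `G₁ ⊠ G₂` computes to `combine` of the two indices, so `∈-×ˢ⁻` applies
    -- directly.
    with ∈-×ˢ⁻ S₁ S₂ u∈ | ∈-×ˢ⁻ S₁ S₂ v∈ | u₁ G₁.≟ v₁
  ... | u₁∈ , _ | v₁∈ , _ | no u₁≢v₁ =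
    -- Adjacency in `⊠` contains, as a component, exactly the `WeakHomomorphism` condition for the
    -- first projection.
    independent-pullback (G₁ ⊠ G₂) G₁ (λ (_ , a₁ , _) → a₁) indep₁ u₁∈ v₁∈ u₁≢v₁
  ... | _ , u₂∈ | _ , v₂∈ | yes refl =
    independent-pullback (G₁ ⊠ G₂) G₂ (λ (_ , _ , a₂) → a₂) indep₂ u₂∈ v₂∈
      (λ u₂≡v₂ → u≢v (cong (u₁ ,_) u₂≡v₂))

theorem2p4 : ∀ (k : ℕ) → k ≥ 1 → ∀ (G₁ G₂ : Graph) → α k (G₁ ⊠ G₂) ≥ α k G₁ * α k G₂
theorem2p4 k _ G₁ G₂ =
  let S₁ , indep₁ , ∣S₁∣≡α = α-attained k G₁
      S₂ , indep₂ , ∣S₂∣≡α = α-attained k G₂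
  in subst (_≤ α k (G₁ ⊠ G₂)) (trans (∣×ˢ∣ S₁ S₂) (cong₂ _*_ ∣S₁∣≡α ∣S₂∣≡α))
       (α-maximum k (G₁ ⊠ G₂) (×ˢ-independent G₁ G₂ indep₁ indep₂))
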